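{- The deterministic $\mathsf{LimSup}$-automata over infinite words are closed under $\min$, with cost $O(n_1\cdot n_2\cdot 2^{m_1+m_2})$.
   Context: A weighted automaton is $A=(Q,q_I,\Sigma,\delta,\gamma)$ with finite state set $Q$, initial state $q_I$, finite alphabet $\Sigma$, total transition relation $\delta\subseteq Q\times\Sigma\times Q$, and weights $\gamma:\delta\to\mathbb{Q}$; deterministic if for all $q,\sigma$ exactly one $q'$ with $(q,\sigma,q')\in\delta$. The run over $w=\sigma_1\sigma_2\dots\in\Sigma^\omega$ is $q_0\sigma_1q_1\dots$ with $q_0=q_I$, $(q_i,\sigma_{i+1},q_{i+1})\in\delta$, weight sequence $v_i=\gamma(q_i,\sigma_{i+1},q_{i+1})$. A $\mathsf{LimSup}$-automaton defines $L_A(w)=\sup$ over runs of $\limsup_nv_n$. $\min(L_1,L_2)(w)=\min\{L_1(w),L_2(w)\}$. A class $\mathcal{C}$ is closed under $\min$ with cost at most $O(f(n_1,m_1,n_2,m_2))$ if for all $A_1,A_2\in\mathcal{C}$, with $A_i$ having $n_i$ states and $m_i$ transitions, one can construct $A_{12}\in\mathcal{C}$ with $L_{A_{12}}=\min(L_{A_1},L_{A_2})$ and $O(f(n_1,m_1,n_2,m_2))$ states. -}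

module Defs where

open import Data.Nat using (ℕ; _*_; _≥_)
open import Data.Fin using (Fin)
open import Data.Product using (_×_; ∃-syntax)
open import Data.Rational using (ℚ; 0ℚ; _+_; _-_; _≤_; _<_)

Word : ℕ → Set
Word k = ℕ → Fin k

-- A deterministic weighted automaton over the alphabet Fin k:
-- states Fin n, initial state, total deterministic transition
-- function δ, and rational weight γ q σ of the (unique) transition (q, σ, δ q σ).
record DetAut (k : ℕ) : Set where
  field
    n    : ℕ
    init : Fin n
    δ    : Fin n → Fin k → Fin n
    γ    : Fin n → Fin k → ℚ

open DetAut public

states : ∀ {k} → DetAut k → ℕ
states A = n A

-- number of transitions: a total deterministic automaton has exactly one
-- transition for each pair (q, σ)
transitions : ∀ {k} → DetAut k → ℕ
transitions {k} A = n A * k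

run : ∀ {k} (A : DetAut k) → Word k → ℕ → Fin (n A)
run A w ℕ.zero    = init A
run A w (ℕ.suc i) = δ A (run A w i) (w i)

weights : ∀ {k} (A : DetAut k) → Word k → ℕ → ℚ
weights A w i = γ A (run A w i) (w i)

IsLimSup : (ℕ → ℚ) → ℚ → Set
IsLimSup v x =
  (∀ ε → 0ℚ < ε → ∃[ N ] (∀ i → i ≥ N → v i ≤ x + ε)) ×
  (∀ ε → 0ℚ < ε → ∀ N → ∃[ i ] (i ≥ N × x - ε ≤ v i))

-- L_A(w) = x  (for a deterministic automaton there is exactly one run,
-- so the sup over runs is the limsup of that run's weights)
Value : ∀ {k} → DetAut k → Word k → ℚ → Set
Value A w x = IsLimSup (weights A w) x

-- Let v₁, v₂ be the weight sequences of A₁, A₂ on a word.  The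
-- product automaton runs A₁ and A₂ side by side and keeps one bit for
-- every threshold θ, where θ ranges over the m₁ + m₂ transition weights
-- of A₁ and A₂.  The bit for θ is set when v₁ reaches θ and cleared when
-- v₂ reaches θ afterwards; at that moment the window is "completed".
-- The product emits min(v₁, v₂) raised to the largest threshold
-- completed at the current step.
--
-- Because weights range over a finite set, a limsup is attained: the
-- sequence is eventually ≤ x and infinitely often ≥ x.  For attained
-- limsups x₁, x₂ the emitted sequence has attained limsup m = x₁ ⊓ x₂:
-- the threshold m is completed infinitely often (v₁ and v₂ both reach
-- it infinitely often), and a threshold above m is eventually never
-- completed (above x₂ because v₂ stays below it, between x₁ and x₂
-- because v₁ never reaches it again).

module Submission where

open import Defs
open import Data.Nat using (ℕ; _+_; _*_; _^_; _≤_)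
open import Data.Product using (_×_; ∃-syntax)
open import Data.Rational using (ℚ; _⊓_)

open import Data.Nat using (zero; suc; _⊔_; _∸_; _<_; s≤s)
import Data.Nat.Properties as ℕₚ
open import Data.Bool using (Bool; true; false; _∧_; _∨_; not; if_then_else_)
open import Data.Bool.Properties using (∨-zeroʳ; ∧-zeroʳ; not-¬)
open import Data.Empty using (⊥-elim)
open import Data.Fin using (Fin; splitAt; combine; remQuot; quotient; remainder;
                            _↑ˡ_; _↑ʳ_; funToFin; finToFun)
  renaming (zero to fzero; suc to fsuc)
open import Data.Fin.Properties using (remQuot-combine; splitAt-↑ˡ; splitAt-↑ʳ;
                                       finToFun-funToFin; 2↔Bool)
open import Data.Product using (_,_; proj₁; proj₂; uncurry)
open import Data.Sum using (inj₁; inj₂; [_,_]′)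
open import Function using (_∘_)
open import Function.Bundles using (Inverse)
open import Relation.Nullary using (¬_; does; proof; yes; no)
open import Relation.Nullary.Reflects using (Reflects; invert)
open import Relation.Binary.Definitions using (tri<; tri≈; tri>)
open import Relation.Nullary.Decidable using (dec-true; dec-false)
open import Relation.Binary.PropositionalEquality
  using (_≡_; refl; sym; trans; cong; cong₂; subst)
import Data.Rational as ℚ
import Data.Rational.Properties as ℚₚ
open import Data.Rational.Solver using (module +-*-Solver)

private
  variable
    M : ℕ
    P Q R : ℕ → Set
    u v : ℕ → ℚ
    x : ℚ

cong₃ : ∀ {A B C D : Set} (f : A → B → C → D) {a a′ b b′ c c′} →
        a ≡ a′ → b ≡ b′ → c ≡ c′ → f a b c ≡ f a′ b′ c′
cong₃ f refl refl refl = refl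

Eventually : (ℕ → Set) → Set
Eventually P = ∃[ N ] (∀ i → N ≤ i → P i)

InfinitelyOften : (ℕ → Set) → Set
InfinitelyOften P = ∀ N → ∃[ i ] (N ≤ i × P i)

eventually-map : (∀ {i} → P i → Q i) → Eventually P → Eventually Q
eventually-map f (N , h) = N , λ i N≤i → f (h i N≤i)

eventually-zip : (∀ {i} → P i → Q i → R i) → Eventually P → Eventually Q → Eventually R
eventually-zip f (N₁ , h₁) (N₂ , h₂) =
  N₁ ⊔ N₂ , λ i N≤i → f (h₁ i (ℕₚ.≤-trans (ℕₚ.m≤m⊔n N₁ N₂) N≤i))
                        (h₂ i (ℕₚ.≤-trans (ℕₚ.m≤n⊔m N₁ N₂) N≤i))

eventually-all : {P : Fin M → ℕ → Set} →
                 (∀ t → Eventually (P t)) → Eventually (λ i → ∀ t → P t i)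
eventually-all {zero}  h = 0 , λ _ _ ()
eventually-all {suc M} h =
  eventually-zip (λ p ps → λ { fzero → p ; (fsuc t) → ps t })
                 (h fzero) (eventually-all (h ∘ fsuc))

-- Attained limsups

AttainedLimSup : (ℕ → ℚ) → ℚ → Set
AttainedLimSup v x = Eventually (λ i → v i ℚ.≤ x) × InfinitelyOften (λ i → x ℚ.≤ v i)

≤-+-pos : ∀ x {ε} → ℚ.0ℚ ℚ.< ε → x ℚ.≤ x ℚ.+ ε
≤-+-pos x {ε} ε>0 = subst (ℚ._≤ x ℚ.+ ε) (ℚₚ.+-identityʳ x) (ℚₚ.+-monoʳ-≤ x (ℚₚ.<⇒≤ ε>0))

-‿pos-≤ : ∀ x {ε} → ℚ.0ℚ ℚ.< ε → x ℚ.- ε ℚ.≤ x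
-‿pos-≤ x {ε} ε>0 = subst (x ℚ.- ε ℚ.≤_) (ℚₚ.+-identityʳ x)
                  (ℚₚ.+-monoʳ-≤ x (ℚₚ.neg-antimono-≤ (ℚₚ.<⇒≤ ε>0)))

attained⇒IsLimSup : AttainedLimSup v x → IsLimSup v x
attained⇒IsLimSup {v} {x} ((N , below) , recurs) = upper , lower
  where
  upper : ∀ ε → ℚ.0ℚ ℚ.< ε → ∃[ N ] (∀ i → N ≤ i → v i ℚ.≤ x ℚ.+ ε)
  upper ε ε>0 = N , λ i N≤i → ℚₚ.≤-trans (below i N≤i) (≤-+-pos x ε>0)
  lower : ∀ ε → ℚ.0ℚ ℚ.< ε → ∀ N → ∃[ i ] (N ≤ i × x ℚ.- ε ℚ.≤ v i)
  lower ε ε>0 N with recurs N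
  ... | i , N≤i , x≤vᵢ = i , N≤i , ℚₚ.≤-trans (-‿pos-≤ x ε>0) x≤vᵢ

attained-cong : (∀ i → u i ≡ v i) → AttainedLimSup v x → AttainedLimSup u x
attained-cong {u} {v} {x} u≗v (below , recurs) =
  eventually-map (λ {i} → subst (ℚ._≤ x) (sym (u≗v i))) below ,
  λ N → let (i , N≤i , x≤vᵢ) = recurs N in i , N≤i , subst (x ℚ.≤_) (sym (u≗v i)) x≤vᵢ

attained-listed : (θ : Fin M → ℚ) → (∀ i → ∃[ t ] θ t ≡ v i) →
                  AttainedLimSup v x → ∃[ t ] θ t ≡ x
attained-listed θ listed ((N , below) , recurs) with recurs N
... | i , N≤i , x≤vᵢ with listed i
...   | t , θt≡vᵢ = t , trans θt≡vᵢ (ℚₚ.≤-antisym (below i N≤i) x≤vᵢ)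

Isolates : ℚ → ℚ → ℚ → Set
Isolates x ε y = (y ℚ.≤ x ℚ.+ ε → y ℚ.≤ x) × (x ℚ.- ε ℚ.≤ y → x ℚ.≤ y)

isolates-shrink : ∀ {ε ε′ y} → ε′ ℚ.≤ ε → Isolates x ε y → Isolates x ε′ y
isolates-shrink {x} ε′≤ε (up , down) =
  (λ y≤x+ε′ → up (ℚₚ.≤-trans y≤x+ε′ (ℚₚ.+-monoʳ-≤ x ε′≤ε))) ,
  (λ x-ε′≤y → down (ℚₚ.≤-trans (ℚₚ.+-monoʳ-≤ x (ℚₚ.neg-antimono-≤ ε′≤ε)) x-ε′≤y))

positive-diff : ∀ {a b} → a ℚ.< b → ℚ.0ℚ ℚ.< b ℚ.- a
positive-diff {a} {b} a<b = subst (ℚ._< b ℚ.- a) (ℚₚ.+-inverseʳ a) (ℚₚ.+-monoˡ-< (ℚ.- a) a<b)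

positive-⊓ : ∀ {a b} → ℚ.0ℚ ℚ.< a → ℚ.0ℚ ℚ.< b → ℚ.0ℚ ℚ.< a ⊓ b
positive-⊓ {a} {b} a>0 b>0 with ℚₚ.⊓-sel a b
... | inj₁ a⊓b≡a = subst (ℚ.0ℚ ℚ.<_) (sym a⊓b≡a) a>0
... | inj₂ a⊓b≡b = subst (ℚ.0ℚ ℚ.<_) (sym a⊓b≡b) b>0

-- Every single value can be isolated from x: pick a rational z strictly
-- between x and y and let ε be the distance from x to z.
isolate : ∀ x y → ∃[ ε ] (ℚ.0ℚ ℚ.< ε × Isolates x ε y)
isolate x y with ℚₚ.<-cmp x y
... | tri≈ _ x≡y _ = ℚ.1ℚ , ℚₚ.positive⁻¹ ℚ.1ℚ ,
                     (λ _ → ℚₚ.≤-reflexive (sym x≡y)) , (λ _ → ℚₚ.≤-reflexive x≡y)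
... | tri< x<y _ _ with ℚₚ.<-dense x<y
...   | z , x<z , z<y = z ℚ.- x , positive-diff x<z , absurd , (λ _ → ℚₚ.<⇒≤ x<y)
  where
  x+[z-x]≡z : x ℚ.+ (z ℚ.- x) ≡ z
  x+[z-x]≡z = +-*-Solver.solve 2 (λ x z → x :+ (z :- x) := z) refl x z
    where open +-*-Solver
  absurd : y ℚ.≤ x ℚ.+ (z ℚ.- x) → y ℚ.≤ x
  absurd y≤z = ⊥-elim (ℚₚ.<-irrefl refl (ℚₚ.<-≤-trans z<y (subst (y ℚ.≤_) x+[z-x]≡z y≤z)))
isolate x y | tri> _ _ y<x with ℚₚ.<-dense y<x
...   | z , y<z , z<x = x ℚ.- z , positive-diff z<x , (λ _ → ℚₚ.<⇒≤ y<x) , absurd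
  where
  x-[x-z]≡z : x ℚ.- (x ℚ.- z) ≡ z
  x-[x-z]≡z = +-*-Solver.solve 2 (λ x z → x :- (x :- z) := z) refl x z
    where open +-*-Solver
  absurd : x ℚ.- (x ℚ.- z) ℚ.≤ y → x ℚ.≤ y
  absurd z≤y = ⊥-elim (ℚₚ.<-irrefl refl (ℚₚ.≤-<-trans (subst (ℚ._≤ y) x-[x-z]≡z z≤y) y<z))

-- Finitely many values can be isolated from x simultaneously, by the
-- minimum of the individual ε's.
isolate-all : ∀ x (θ : Fin M → ℚ) → ∃[ ε ] (ℚ.0ℚ ℚ.< ε × ∀ t → Isolates x ε (θ t))
isolate-all {zero}  x θ = ℚ.1ℚ , ℚₚ.positive⁻¹ ℚ.1ℚ , λ ()
isolate-all {suc M} x θ with isolate x (θ fzero) | isolate-all x (θ ∘ fsuc)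
... | ε₀ , ε₀>0 , iso₀ | ε , ε>0 , iso =
  ε₀ ⊓ ε , positive-⊓ ε₀>0 ε>0 ,
  λ { fzero    → isolates-shrink (ℚₚ.p⊓q≤p ε₀ ε) iso₀
    ; (fsuc t) → isolates-shrink (ℚₚ.p⊓q≤q ε₀ ε) (iso t) }

listed⇒attained : (θ : Fin M → ℚ) → (∀ i → ∃[ t ] θ t ≡ v i) →
                  IsLimSup v x → AttainedLimSup v x
listed⇒attained {v = v} {x} θ listed (upper , lower) with isolate-all x θ
... | ε , ε>0 , iso = eventually-map (λ {i} → proj₁ (isolated i)) (upper ε ε>0) ,
                      λ N → let (i , N≤i , x-ε≤vᵢ) = lower ε ε>0 N
                            in i , N≤i , proj₂ (isolated i) x-ε≤vᵢ
  where
  isolated : ∀ i → Isolates x ε (v i)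
  isolated i = let (t , θt≡vᵢ) = listed i in subst (Isolates x ε) θt≡vᵢ (iso t)

maxOver : (Fin M → ℚ) → (Fin M → Bool) → ℚ → ℚ
maxOver {zero}  θ c b = b
maxOver {suc M} θ c b =
  if c fzero then θ fzero ℚ.⊔ maxOver (θ ∘ fsuc) (c ∘ fsuc) b
             else maxOver (θ ∘ fsuc) (c ∘ fsuc) b

maxOver-ub : ∀ (θ : Fin M → ℚ) c b t → c t ≡ true → θ t ℚ.≤ maxOver θ c b
maxOver-ub θ c b fzero    ct rewrite ct = ℚₚ.p≤p⊔q _ _
maxOver-ub θ c b (fsuc t) ct with c fzero
... | true  = ℚₚ.≤-trans (maxOver-ub (θ ∘ fsuc) (c ∘ fsuc) b t ct) (ℚₚ.p≤q⊔p (θ fzero) _)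
... | false = maxOver-ub (θ ∘ fsuc) (c ∘ fsuc) b t ct

maxOver-lub : ∀ (θ : Fin M → ℚ) c {b y} → b ℚ.≤ y →
              (∀ t → c t ≡ true → θ t ℚ.≤ y) → maxOver θ c b ℚ.≤ y
maxOver-lub {zero}  θ c b≤y θ≤y = b≤y
maxOver-lub {suc M} θ c b≤y θ≤y with c fzero in c₀
... | true  = ℚₚ.⊔-lub (θ≤y fzero c₀) (maxOver-lub (θ ∘ fsuc) (c ∘ fsuc) b≤y (θ≤y ∘ fsuc))
... | false = maxOver-lub (θ ∘ fsuc) (c ∘ fsuc) b≤y (θ≤y ∘ fsuc)

maxOver-cong : ∀ (θ : Fin M → ℚ) {c c′ b b′} →
               (∀ t → c t ≡ c′ t) → b ≡ b′ → maxOver θ c b ≡ maxOver θ c′ b′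
maxOver-cong {zero}  θ c≗c′ refl = refl
maxOver-cong {suc M} θ c≗c′ b≡b′
  rewrite c≗c′ fzero | maxOver-cong (θ ∘ fsuc) (c≗c′ ∘ fsuc) b≡b′ = refl

-- The threshold monitor

reaches : ℚ → ℚ → Bool
reaches th a = does (th ℚₚ.≤? a)

reaches-true : ∀ {th a} → th ℚ.≤ a → reaches th a ≡ true
reaches-true {th} {a} = dec-true (th ℚₚ.≤? a)

reaches-false : ∀ {th a} → ¬ th ℚ.≤ a → reaches th a ≡ false
reaches-false {th} {a} = dec-false (th ℚₚ.≤? a)

reaches-sound : ∀ {th a} → reaches th a ≡ true → th ℚ.≤ a
reaches-sound {th} {a} r = invert (subst (Reflects (th ℚ.≤ a)) r (proof (th ℚₚ.≤? a)))

-- One step of the monitor for threshold th, from bit p, when A₁ emits a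
-- and A₂ emits b: the window is armed if it was pending or a reaches th;
-- it is completed if it is armed and b reaches th, and stays pending otherwise.
nextBit : ℚ → Bool → ℚ → ℚ → Bool
nextBit th p a b = (p ∨ reaches th a) ∧ not (reaches th b)

completesᵇ : ℚ → Bool → ℚ → ℚ → Bool
completesᵇ th p a b = (p ∨ reaches th a) ∧ reaches th b

module Monitor (θ : Fin M → ℚ) (v₁ v₂ : ℕ → ℚ) where

  -- bit th i: v₁ has reached th since v₂ last did (before step i).
  bit : ℚ → ℕ → Bool
  bit th zero    = false
  bit th (suc i) = nextBit th (bit th i) (v₁ i) (v₂ i)

  armed : ℚ → ℕ → Bool
  armed th i = bit th i ∨ reaches th (v₁ i)

  completes : ℚ → ℕ → Bool
  completes th i = completesᵇ th (bit th i) (v₁ i) (v₂ i)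

  output : ℕ → ℚ
  output i = maxOver θ (λ t → completes (θ t) i) (v₁ i ⊓ v₂ i)

  completes-sound : ∀ {th i} → completes th i ≡ true → th ℚ.≤ v₂ i
  completes-sound {th} {i} c with armed th i
  ... | true = reaches-sound c

  completes-by : ∀ {th j i} → j ≤ i → armed th j ≡ true → th ℚ.≤ v₂ i →
                 ∃[ j′ ] (j ≤ j′ × completes th j′ ≡ true)
  completes-by {th} {j} {i} j≤i armedⱼ th≤v₂ᵢ =
    go (i ∸ j) j armedⱼ (subst (λ k → th ℚ.≤ v₂ k) (sym (ℕₚ.m+[n∸m]≡n j≤i)) th≤v₂ᵢ)
    where
    go : ∀ d j → armed th j ≡ true → th ℚ.≤ v₂ (j + d) →
         ∃[ j′ ] (j ≤ j′ × completes th j′ ≡ true)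
    go d j armedⱼ th≤v₂ with reaches th (v₂ j) in rⱼ
    ... | true = j , ℕₚ.≤-refl , cong₂ _∧_ armedⱼ rⱼ
    go zero j armedⱼ th≤v₂ | false
      with () ← trans (sym (reaches-true (subst (λ k → th ℚ.≤ v₂ k) (ℕₚ.+-identityʳ j) th≤v₂))) rⱼ
    go (suc d) j armedⱼ th≤v₂ | false
      with go d (suc j) still-armed (subst (λ k → th ℚ.≤ v₂ k) (ℕₚ.+-suc j d) th≤v₂)
      where
      -- v₂ j misses th, so the window stays pending at j + 1
      still-armed : armed th (suc j) ≡ true
      still-armed = cong (_∨ _) (cong₂ (λ a r → a ∧ not r) armedⱼ rⱼ)
    ... | j′ , sj≤j′ , c = j′ , ℕₚ.≤-trans (ℕₚ.n≤1+n j) sj≤j′ , c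

  silenced : ∀ {th N s} → (∀ i → N ≤ i → ¬ th ℚ.≤ v₁ i) → N ≤ s → th ℚ.≤ v₂ s →
             ∀ {i} → s < i → ¬ completes th i ≡ true
  silenced {th} {N} {s} v₁-low N≤s th≤v₂ₛ s<i c = not-¬ c (cong (_∧ _) (disarmed s<i))
    where
    disarmed : ∀ {i} → s < i → armed th i ≡ false
    cleared : ∀ {i} → s < i → bit th i ≡ false
    disarmed {i} s<i = cong₂ _∨_ (cleared s<i)
      (reaches-false (v₁-low i (ℕₚ.≤-trans N≤s (ℕₚ.<⇒≤ s<i))))
    cleared {suc i} (s≤s s≤i) with ℕₚ.m≤n⇒m<n∨m≡n s≤i
    ... | inj₁ s<i  = cong (λ a → a ∧ _) (disarmed s<i)
    ... | inj₂ refl = trans (cong (λ r → armed th s ∧ not r) (reaches-true th≤v₂ₛ))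
                            (∧-zeroʳ _)

-- The core argument: the monitor output has limsup x₁ ⊓ x₂

module MinOfAttained (θ : Fin M → ℚ) (v₁ v₂ : ℕ → ℚ) {x₁ x₂ : ℚ}
                     (h₁ : AttainedLimSup v₁ x₁) (h₂ : AttainedLimSup v₂ x₂) where

  open Monitor θ v₁ v₂

  m : ℚ
  m = x₁ ⊓ x₂

  -- The threshold m is completed infinitely often: v₁ reaches x₁ ≥ m
  -- infinitely often, and each time v₂ later reaches x₂ ≥ m.
  m-recurs : InfinitelyOften (λ i → completes m i ≡ true)
  m-recurs N with proj₂ h₁ N
  ... | i₁ , N≤i₁ , x₁≤v₁ with proj₂ h₂ i₁
  ...   | i₂ , i₁≤i₂ , x₂≤v₂ with completes-by i₁≤i₂ armed-i₁ (ℚₚ.≤-trans (ℚₚ.p⊓q≤q x₁ x₂) x₂≤v₂)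
    where
    armed-i₁ : armed m i₁ ≡ true
    armed-i₁ = trans (cong (bit m i₁ ∨_)
                       (reaches-true (ℚₚ.≤-trans (ℚₚ.p⊓q≤p x₁ x₂) x₁≤v₁)))
                     (∨-zeroʳ _)
  ...     | j , i₁≤j , c = j , ℕₚ.≤-trans N≤i₁ i₁≤j , c

  above-m-ceases : ∀ th → Eventually (λ i → completes th i ≡ true → th ℚ.≤ m)
  above-m-ceases th with th ℚₚ.≤? m
  ... | yes th≤m = 0 , λ _ _ _ → th≤m
  ... | no th≰m with th ℚₚ.≤? x₂
  ...   | no th≰x₂ = eventually-map
                       (λ v₂≤x₂ c → ⊥-elim (th≰x₂ (ℚₚ.≤-trans (completes-sound c) v₂≤x₂)))
                       (proj₁ h₂)
  ...   | yes th≤x₂ with proj₁ h₁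
  ...     | N , v₁≤x₁ with proj₂ h₂ N
  ...       | s , N≤s , x₂≤v₂ₛ = suc s , λ i s<i c → ⊥-elim (silence s<i c)
    where
    v₁-low : ∀ i → N ≤ i → ¬ th ℚ.≤ v₁ i
    v₁-low i N≤i th≤v₁ = th≰m (ℚₚ.⊓-glb (ℚₚ.≤-trans th≤v₁ (v₁≤x₁ i N≤i)) th≤x₂)
    silence : ∀ {i} → s < i → ¬ completes th i ≡ true
    silence = silenced v₁-low N≤s (ℚₚ.≤-trans th≤x₂ x₂≤v₂ₛ)

  output-attained : ∃[ t ] θ t ≡ m → AttainedLimSup output m
  output-attained (t₀ , θt₀≡m) = eventually-zip bound
      (eventually-zip ℚₚ.⊓-mono-≤ (proj₁ h₁) (proj₁ h₂))
      (eventually-all (λ t → above-m-ceases (θ t))) ,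
    λ N → let (i , N≤i , c) = m-recurs N in
          i , N≤i , subst (ℚ._≤ output i) θt₀≡m
                      (maxOver-ub θ _ _ t₀ (subst (λ th → completes th i ≡ true) (sym θt₀≡m) c))
    where
    bound : ∀ {i} → v₁ i ⊓ v₂ i ℚ.≤ m → (∀ t → completes (θ t) i ≡ true → θ t ℚ.≤ m) →
            output i ℚ.≤ m
    bound = maxOver-lub θ _

-- The product automaton

transitionWeight : ∀ {k} (A : DetAut k) → Fin (transitions A) → ℚ
transitionWeight {k} A = uncurry (γ A) ∘ remQuot k

weight-listed : ∀ {k} (A : DetAut k) w i → ∃[ t ] transitionWeight A t ≡ weights A w i
weight-listed A w i = combine (run A w i) (w i) , cong (uncurry (γ A)) (remQuot-combine _ _)

module Product {k} (A₁ A₂ : DetAut k) where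

  m₁ m₂ : ℕ
  m₁ = transitions A₁
  m₂ = transitions A₂

  θ : Fin (m₁ + m₂) → ℚ
  θ = [ transitionWeight A₁ , transitionWeight A₂ ]′ ∘ splitAt m₁

  θ-listed₁ : ∀ w i → ∃[ t ] θ t ≡ weights A₁ w i
  θ-listed₁ w i = let (t , e) = weight-listed A₁ w i
                  in t ↑ˡ m₂ , trans (cong [ _ , _ ]′ (splitAt-↑ˡ m₁ t m₂)) e

  θ-listed₂ : ∀ w i → ∃[ t ] θ t ≡ weights A₂ w i
  θ-listed₂ w i = let (t , e) = weight-listed A₂ w i
                  in m₁ ↑ʳ t , trans (cong [ _ , _ ]′ (splitAt-↑ʳ m₁ m₂ t)) e

  -- States are triples (q₁, q₂, bits) encoded into Fin Size.
  Size : ℕ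
  Size = n A₁ * n A₂ * 2 ^ (m₁ + m₂)

  open Inverse 2↔Bool using (to; from; strictlyInverseˡ)

  encode : Fin (n A₁) → Fin (n A₂) → (Fin (m₁ + m₂) → Bool) → Fin Size
  encode q₁ q₂ bs = combine (combine q₁ q₂) (funToFin (from ∘ bs))

  state₁ : Fin Size → Fin (n A₁)
  state₁ s = quotient (n A₂) (quotient {n A₁ * n A₂} (2 ^ (m₁ + m₂)) s)

  state₂ : Fin Size → Fin (n A₂)
  state₂ s = remainder {n A₁} (n A₂) (quotient {n A₁ * n A₂} (2 ^ (m₁ + m₂)) s)

  bits : Fin Size → Fin (m₁ + m₂) → Bool
  bits s = to ∘ finToFun (remainder {n A₁ * n A₂} (2 ^ (m₁ + m₂)) s)

  state₁-encode : ∀ q₁ q₂ bs → state₁ (encode q₁ q₂ bs) ≡ q₁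
  state₁-encode q₁ q₂ bs =
    trans (cong (quotient {n A₁} (n A₂) ∘ proj₁) (remQuot-combine {n A₁ * n A₂} {2 ^ (m₁ + m₂)} (combine q₁ q₂) _))
          (cong proj₁ (remQuot-combine q₁ q₂))

  state₂-encode : ∀ q₁ q₂ bs → state₂ (encode q₁ q₂ bs) ≡ q₂
  state₂-encode q₁ q₂ bs =
    trans (cong (remainder {n A₁} (n A₂) ∘ proj₁) (remQuot-combine {n A₁ * n A₂} {2 ^ (m₁ + m₂)} (combine q₁ q₂) _))
          (cong proj₂ (remQuot-combine q₁ q₂))

  bits-encode : ∀ q₁ q₂ bs t → bits (encode q₁ q₂ bs) t ≡ bs t
  bits-encode q₁ q₂ bs t =
    trans (cong (λ r → to (finToFun (proj₂ r) t)) (remQuot-combine {n A₁ * n A₂} {2 ^ (m₁ + m₂)} (combine q₁ q₂) _))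
          (trans (cong to (finToFun-funToFin (from ∘ bs) t)) (strictlyInverseˡ (bs t)))

  nextBits : Fin Size → Fin k → Fin (m₁ + m₂) → Bool
  nextBits s σ t = nextBit (θ t) (bits s t) (γ A₁ (state₁ s) σ) (γ A₂ (state₂ s) σ)

  initial : Fin Size
  initial = encode (init A₁) (init A₂) (λ _ → false)

  step : Fin Size → Fin k → Fin Size
  step s σ = encode (δ A₁ (state₁ s) σ) (δ A₂ (state₂ s) σ) (nextBits s σ)

  emit : Fin Size → Fin k → ℚ
  emit s σ = maxOver θ (λ t → completesᵇ (θ t) (bits s t) (γ A₁ (state₁ s) σ) (γ A₂ (state₂ s) σ))
                       (γ A₁ (state₁ s) σ ⊓ γ A₂ (state₂ s) σ)

  A₁₂ : DetAut k
  A₁₂ = record { n = Size ; init = initial ; δ = step ; γ = emit }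

  module OnWord (w : Word k) where

    open Monitor θ (weights A₁ w) (weights A₂ w)

    run₁ : ∀ i → state₁ (run A₁₂ w i) ≡ run A₁ w i
    run₁ zero    = state₁-encode (init A₁) (init A₂) (λ _ → false)
    run₁ (suc i) = trans (state₁-encode (δ A₁ (state₁ s) (w i)) (δ A₂ (state₂ s) (w i)) (nextBits s (w i)))
                         (cong (λ q → δ A₁ q (w i)) (run₁ i))
      where s = run A₁₂ w i

    run₂ : ∀ i → state₂ (run A₁₂ w i) ≡ run A₂ w i
    run₂ zero    = state₂-encode (init A₁) (init A₂) (λ _ → false)
    run₂ (suc i) = trans (state₂-encode (δ A₁ (state₁ s) (w i)) (δ A₂ (state₂ s) (w i)) (nextBits s (w i)))
                         (cong (λ q → δ A₂ q (w i)) (run₂ i))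
      where s = run A₁₂ w i

    weight₁ : ∀ i → γ A₁ (state₁ (run A₁₂ w i)) (w i) ≡ weights A₁ w i
    weight₁ i = cong (λ q → γ A₁ q (w i)) (run₁ i)

    weight₂ : ∀ i → γ A₂ (state₂ (run A₁₂ w i)) (w i) ≡ weights A₂ w i
    weight₂ i = cong (λ q → γ A₂ q (w i)) (run₂ i)

    run-bits : ∀ i t → bits (run A₁₂ w i) t ≡ bit (θ t) i
    run-bits zero    t = bits-encode (init A₁) (init A₂) (λ _ → false) t
    run-bits (suc i) t =
      trans (bits-encode (δ A₁ (state₁ s) (w i)) (δ A₂ (state₂ s) (w i)) (nextBits s (w i)) t)
            (cong₃ (nextBit (θ t)) (run-bits i t) (weight₁ i) (weight₂ i))
      where s = run A₁₂ w i

    weights-output : ∀ i → weights A₁₂ w i ≡ output i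
    weights-output i =
      maxOver-cong θ (λ t → cong₃ (completesᵇ (θ t)) (run-bits i t) (weight₁ i) (weight₂ i))
                     (cong₂ _⊓_ (weight₁ i) (weight₂ i))

    correct : ∀ x₁ x₂ → Value A₁ w x₁ → Value A₂ w x₂ → Value A₁₂ w (x₁ ⊓ x₂)
    correct x₁ x₂ h₁ h₂ =
      attained⇒IsLimSup (attained-cong weights-output (output-attained m-is-threshold))
      where
      att₁ = listed⇒attained (transitionWeight A₁) (weight-listed A₁ w) h₁
      att₂ = listed⇒attained (transitionWeight A₂) (weight-listed A₂ w) h₂
      open MinOfAttained θ (weights A₁ w) (weights A₂ w) att₁ att₂
      m-is-threshold : ∃[ t ] θ t ≡ x₁ ⊓ x₂
      m-is-threshold with ℚₚ.⊓-sel x₁ x₂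
      ... | inj₁ m≡x₁ = let (t , e) = attained-listed θ (θ-listed₁ w) att₁ in t , trans e (sym m≡x₁)
      ... | inj₂ m≡x₂ = let (t , e) = attained-listed θ (θ-listed₂ w) att₂ in t , trans e (sym m≡x₂)

theorem4p8 : ∃[ C ] (∀ {k : ℕ} (A₁ A₂ : DetAut k) →
    ∃[ A₁₂ ] ((∀ (w : Word k) (x₁ x₂ : ℚ) → Value A₁ w x₁ → Value A₂ w x₂ →
    Value A₁₂ w (x₁ ⊓ x₂))
    × states A₁₂ ≤ C * (states A₁ * states A₂ * 2 ^ (transitions A₁ + transitions A₂))))
theorem4p8 = 1 , λ A₁ A₂ →
  Product.A₁₂ A₁ A₂ ,
  (λ w → Product.OnWord.correct A₁ A₂ w) ,
  ℕₚ.≤-reflexive (sym (ℕₚ.*-identityˡ _))
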